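{- Let $\mathcal{H}=\{rrr,bby,yyb\}$. Then $h_2(n,\mathcal{H})=\lceil n/2\rceil$.
   Context: Here $n$ denotes the number of vertices of the complete graph $K_n$. Edge-colorings of $K_n$ use colors from $\{r,b,y\}$ (red, blue, yellow); they need not be proper, and not all colors need be used. A pattern is an edge-colored triangle, denoted by the multiset of the colors of its three edges; e.g. $rrr$ is the all-red triangle, $bby$ is the triangle with two blue edges and one yellow edge, and $yyb$ has two yellow edges and one blue edge. For a family $\mathcal{H}$ of patterns, $\operatorname{Forb}(n,\mathcal{H})$ is the set of all edge-colorings of $K_n$ with colors from $\{r,b,y\}$ in which no triangle has a coloring belonging to $\mathcal{H}$. For an edge-coloring $c$ of $K_n$, $h_2(c)$ is the maximum $k$ such that there is a set of $k$ vertices whose induced edges use at most two of the three colors. Finally, $h_2(n,\mathcal{H})=\min\{h_2(c): c\in\operatorname{Forb}(n,\mathcal{H})\}$.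
   Formalization: The case n = 2 is excluded, because the formula fails there: K_2 has a single edge and no triangle, so h_2(2,H) = 2 while ⌈2/2⌉ = 1; all other n are covered. -}

module Defs where

open import Data.Fin.Base using (Fin)
open import Data.Fin.Subset using (Subset; ∣_∣; _∈_)
open import Data.List.Base using (List; []; _∷_)
open import Data.List.Membership.Propositional renaming (_∈_ to _∈ˡ_)
open import Data.List.Relation.Binary.Permutation.Propositional using (_↭_)
open import Data.Nat.Base using (ℕ; _≤_)
open import Data.Product.Base using (∃; ∃₂; _×_)
open import Data.Sum.Base using (_⊎_)
open import Data.Vec.Base using (Vec; []; _∷_; toList)
open import Relation.Binary.PropositionalEquality.Core using (_≡_; _≢_)
open import Relation.Nullary.Negation.Core using (¬_)

data Colour : Set where
  r b y : Colour

-- Only the values at distinct vertices are edge colours; the values on the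
-- diagonal are arbitrary and no definition below looks at them.
record EdgeColouring (n : ℕ) : Set where
  field
    colour : Fin n → Fin n → Colour
    sym    : ∀ i j → colour i j ≡ colour j i

open EdgeColouring public

-- A pattern stands for the multiset of its three entries: it is only ever
-- compared up to permutation.
Pattern : Set
Pattern = Vec Colour 3

HasPattern : ∀ {n} → EdgeColouring n → Fin n → Fin n → Fin n → Pattern → Set
HasPattern c i j k p =
  (colour c i j ∷ colour c j k ∷ colour c i k ∷ []) ↭ toList p

Forb : (n : ℕ) → List Pattern → EdgeColouring n → Set
Forb n H c = ∀ i j k → i ≢ j → j ≢ k → i ≢ k →
             ∀ p → p ∈ˡ H → ¬ HasPattern c i j k p

UsesAtMostTwoColours : ∀ {n} → EdgeColouring n → Subset n → Set
UsesAtMostTwoColours c S =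
  ∃₂ λ α β → ∀ i j → i ∈ S → j ∈ S → i ≢ j →
             colour c i j ≡ α ⊎ colour c i j ≡ β

IsMaximum : (ℕ → Set) → ℕ → Set
IsMaximum P m = P m × (∀ k → P k → k ≤ m)

IsMinimum : (ℕ → Set) → ℕ → Set
IsMinimum P m = P m × (∀ k → P k → m ≤ k)

-- h₂(c) and h₂(n, H) are given by their graphs: h₂[ c ]≡ k says that the
-- maximum defining h₂(c) is k, and h₂[ n , H ]≡ m that the minimum defining
-- h₂(n, H) is attained and equal to m.
h₂[_]≡_ : ∀ {n} → EdgeColouring n → ℕ → Set
h₂[_]≡_ {n} c =
  IsMaximum λ k → ∃ λ (S : Subset n) → ∣ S ∣ ≡ k × UsesAtMostTwoColours c S

h₂[_,_]≡_ : ℕ → List Pattern → ℕ → Set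
h₂[ n , H ]≡ m =
  IsMinimum (λ k → ∃ λ (c : EdgeColouring n) → Forb n H c × h₂[ c ]≡ k) m

rrr bby yyb : Pattern
rrr = r ∷ r ∷ r ∷ []
bby = b ∷ b ∷ y ∷ []
yyb = y ∷ y ∷ b ∷ []

𝓗 : List Pattern
𝓗 = rrr ∷ bby ∷ yyb ∷ []

{-# OPTIONS --safe #-}

-- Lower bound. If no vertex meets both a blue and a yellow edge, the vertices
-- meeting a yellow edge span no blue edge and the others span no yellow edge, so
-- one of these two sets is large enough. Otherwise let v u be blue and v w be
-- yellow. Apart from v, the vertices joined in red to some blue neighbour of v
-- and the remaining vertices form two cliques without red edges, and such a
-- clique has only one colour. If neither clique is large enough, either lacks a
-- single vertex, and one of them can be extended without creating a third
-- colour: by v, or else by one end of a non-red edge between the two cliques.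
--
-- Upper bound. Split the vertices into two blue cliques joined by a yellow
-- matching, all other edges being red.
module Submission where

open import Defs
open import Data.Bool.Base using (true; false)
open import Data.Empty using (⊥-elim)
open import Data.Fin.Base using (Fin; zero; suc; inject≤; quotient; remainder; combine)
open import Data.Fin.Properties
  using (_≟_; any?; suc-injective; injective⇒≤; inject≤-injective; combine-remQuot)
open import Data.Fin.Subset using (Subset; ∣_∣; _∈_; _∉_; _∪_; ⁅_⁆; ∁)
open import Data.Fin.Subset.Properties
open import Data.List.Base using ([]; _∷_; map)
open import Data.List.Membership.Propositional using () renaming (_∈_ to _∈ˡ_)
open import Data.List.Relation.Binary.Permutation.Propositional
  using (refl; prep; swap; trans)
open import Data.List.Relation.Binary.Permutation.Propositional.Properties using (map⁺)
open import Data.List.Relation.Unary.Any using (here; there)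
open import Data.Nat.Base
  using (ℕ; zero; suc; _+_; _*_; _≤_; _<_; z≤n; s≤s; ⌈_/2⌉; ⌊_/2⌋)
open import Data.Nat.ListAction using (sum)
open import Data.Nat.ListAction.Properties using (sum-↭)
open import Data.Nat.Properties as ℕ
  using (≤-trans; ≤-refl; ≤-reflexive; ≤-antisym; n≤1+n)
open import Data.Product.Base using (∃; ∃₂; ∃-syntax; _×_; _,_; proj₁; proj₂)
open import Data.Sum.Base using (_⊎_; inj₁; inj₂; [_,_]′)
open import Data.Vec.Base using ([]; _∷_; toList; tabulate; here; there)
open import Data.Vec.Properties using (lookup∘tabulate; lookup⇒[]=; []=⇒lookup)
open import Function.Base using (_∘_; id)
open import Level using (0ℓ)
open import Relation.Binary.Definitions using (DecidableEquality)
open import Relation.Binary.PropositionalEquality as ≡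
  using (_≡_; _≢_; refl; cong; cong₂)
open import Relation.Nullary using (Dec; yes; no; does; ¬_; contradiction; ¬?; _×-dec_)
open import Relation.Nullary.Decidable using (dec-true; decidable-stable)
open import Relation.Unary using (Pred; Decidable)

private variable
  m n : ℕ

-- Two-coloured sets as sets that miss a colour

_≟ᶜ_ : DecidableEquality Colour
r ≟ᶜ r = yes refl
r ≟ᶜ b = no λ ()
r ≟ᶜ y = no λ ()
b ≟ᶜ r = no λ ()
b ≟ᶜ b = yes refl
b ≟ᶜ y = no λ ()
y ≟ᶜ r = no λ ()
y ≟ᶜ b = no λ ()
y ≟ᶜ y = yes refl

-- With three colours, using at most two amounts to missing one; the arguments below name only the
-- missing colour.
Avoids : EdgeColouring n → Colour → Subset n → Set
Avoids c γ S = ∀ {i j} → i ∈ S → j ∈ S → i ≢ j → colour c i j ≢ γ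

others : ∀ (γ : Colour) → ∃₂ λ α β → ∀ δ → δ ≢ γ → δ ≡ α ⊎ δ ≡ β
others r = b , y , λ { r δ≢ → contradiction refl δ≢ ; b _ → inj₁ refl ; y _ → inj₂ refl }
others b = r , y , λ { b δ≢ → contradiction refl δ≢ ; r _ → inj₁ refl ; y _ → inj₂ refl }
others y = r , b , λ { y δ≢ → contradiction refl δ≢ ; r _ → inj₁ refl ; b _ → inj₂ refl }

third : ∀ (α β : Colour) → ∃[ γ ] α ≢ γ × β ≢ γ
third r r = b , (λ ()) , (λ ())
third r b = y , (λ ()) , (λ ())
third r y = b , (λ ()) , (λ ())
third b r = y , (λ ()) , (λ ())
third b b = r , (λ ()) , (λ ())
third b y = r , (λ ()) , (λ ())
third y r = b , (λ ()) , (λ ())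
third y b = r , (λ ()) , (λ ())
third y y = r , (λ ()) , (λ ())

avoids⇒twoColours : ∀ (c : EdgeColouring n) γ {S} → Avoids c γ S → UsesAtMostTwoColours c S
avoids⇒twoColours c γ avoids with others γ
... | α , β , cover = α , β , λ i j i∈S j∈S i≢j → cover _ (avoids i∈S j∈S i≢j)

twoColours⇒avoids : ∀ (c : EdgeColouring n) {S} → UsesAtMostTwoColours c S → ∃[ γ ] Avoids c γ S
twoColours⇒avoids c (α , β , two) with third α β
... | γ , α≢γ , β≢γ = γ , λ i∈S j∈S i≢j cij≡γ →
  [ (λ cij≡α → α≢γ (≡.trans (≡.sym cij≡α) cij≡γ))
  , (λ cij≡β → β≢γ (≡.trans (≡.sym cij≡β) cij≡γ)) ]′ (two _ _ i∈S j∈S i≢j)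

-- Finite subsets

comprehension : ∀ {P : Pred (Fin n) 0ℓ} → Decidable P → Subset n
comprehension P? = tabulate (does ∘ P?)

module _ {P : Pred (Fin n) 0ℓ} (P? : Decidable P) where

  ∈-comprehension⁺ : ∀ {x} → P x → x ∈ comprehension P?
  ∈-comprehension⁺ {x} px =
    lookup⇒[]= x _ (≡.trans (lookup∘tabulate _ x) (dec-true (P? x) px))

  ∈-comprehension⁻ : ∀ {x} → x ∈ comprehension P? → P x
  ∈-comprehension⁻ {x} x∈ =
    witness (P? x) (≡.trans (≡.sym (lookup∘tabulate _ x)) ([]=⇒lookup x∈))
    where
    witness : ∀ {A : Set} (a? : Dec A) → does a? ≡ true → A
    witness (yes a) _ = a

∣p∪⁅x⁆∣≤1+∣p∣ : ∀ (p : Subset n) x → ∣ p ∪ ⁅ x ⁆ ∣ ≤ suc ∣ p ∣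
∣p∪⁅x⁆∣≤1+∣p∣ (true  ∷ p) zero    rewrite ∪-identityʳ p = n≤1+n _
∣p∪⁅x⁆∣≤1+∣p∣ (false ∷ p) zero    rewrite ∪-identityʳ p = ≤-refl
∣p∪⁅x⁆∣≤1+∣p∣ (true  ∷ p) (suc x) = s≤s (∣p∪⁅x⁆∣≤1+∣p∣ p x)
∣p∪⁅x⁆∣≤1+∣p∣ (false ∷ p) (suc x) = ∣p∪⁅x⁆∣≤1+∣p∣ p x

x∉p⇒∣p∣<∣p∪⁅x⁆∣ : ∀ {p : Subset n} {x} → x ∉ p → ∣ p ∣ < ∣ p ∪ ⁅ x ⁆ ∣
x∉p⇒∣p∣<∣p∪⁅x⁆∣ {p = p} {x} x∉p =
  p⊂q⇒∣p∣<∣q∣ (p⊆p∪q ⁅ x ⁆ , x , q⊆p∪q p ⁅ x ⁆ (x∈⁅x⁆ x) , x∉p)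

n≤∣p∣+∣∁p∣ : ∀ (p : Subset n) → n ≤ ∣ p ∣ + ∣ ∁ p ∣
n≤∣p∣+∣∁p∣ {n} p rewrite ∣∁p∣≡n∸∣p∣ p = ℕ.m≤n+m∸n n ∣ p ∣

-- Enumerates `S` in increasing order, so that cardinality bounds follow from injections between
-- `Fin` types.
element : (S : Subset n) → Fin ∣ S ∣ → Fin n
element (true  ∷ S) zero    = zero
element (true  ∷ S) (suc i) = suc (element S i)
element (false ∷ S) i       = suc (element S i)

element∈ : ∀ (S : Subset n) i → element S i ∈ S
element∈ (true  ∷ S) zero    = here
element∈ (true  ∷ S) (suc i) = there (element∈ S i)
element∈ (false ∷ S) i       = there (element∈ S i)

element-injective : ∀ (S : Subset n) {i j} → element S i ≡ element S j → i ≡ j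
element-injective (true  ∷ S) {zero}  {zero}  _  = refl
element-injective (true  ∷ S) {suc i} {suc j} eq =
  cong suc (element-injective S (suc-injective eq))
element-injective (false ∷ S) eq = element-injective S (suc-injective eq)

injectiveOn⇒∣S∣≤ : ∀ (S : Subset n) (f : Fin n → Fin m) →
                   (∀ {i j} → i ∈ S → j ∈ S → f i ≡ f j → i ≡ j) → ∣ S ∣ ≤ m
injectiveOn⇒∣S∣≤ S f inj =
  injective⇒≤ (λ eq → element-injective S (inj (element∈ S _) (element∈ S _) eq))

-- Halving

⌈n/2⌉≤1+⌊n/2⌋ : ∀ n → ⌈ n /2⌉ ≤ suc ⌊ n /2⌋
⌈n/2⌉≤1+⌊n/2⌋ n = ℕ.⌊n/2⌋-mono (n≤1+n (suc n))

m+o≤p+q∧p≤o⇒m≤q : ∀ {m o p q} → m + o ≤ p + q → p ≤ o → m ≤ q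
m+o≤p+q∧p≤o⇒m≤q {m} {o} {p} {q} m+o≤p+q p≤o = ℕ.+-cancelʳ-≤ o m q (begin
  m + o ≤⟨ m+o≤p+q ⟩
  p + q ≤⟨ ℕ.+-monoˡ-≤ q p≤o ⟩
  o + q ≡⟨ ℕ.+-comm o q ⟩
  q + o ∎)
  where open ℕ.≤-Reasoning

n≤p+q⇒⌈n/2⌉≤ : ∀ n {p q} → n ≤ p + q → ⌈ n /2⌉ ≤ p ⊎ ⌈ n /2⌉ ≤ q
n≤p+q⇒⌈n/2⌉≤ n {p} n≤p+q with ⌈ n /2⌉ ℕ.≤? p
... | yes ≤p = inj₁ ≤p
-- Here `suc p ≤ ⌈ n /2⌉`. Adding one to both sides of `⌊ n /2⌋ + ⌈ n /2⌉ ≤ p + q` and cancelling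
-- leaves `suc ⌊ n /2⌋ ≤ q`.
... | no  ≰p = inj₂ (≤-trans (⌈n/2⌉≤1+⌊n/2⌋ n)
  (m+o≤p+q∧p≤o⇒m≤q
    (s≤s (≤-trans (≤-reflexive (ℕ.⌊n/2⌋+⌈n/2⌉≡n n)) n≤p+q)) (ℕ.≰⇒> ≰p)))

n≤1+p+q⇒⌈n/2⌉≤ : ∀ n {p q} → n ≤ suc (p + q) →
                 ⌈ n /2⌉ ≤ p ⊎ ⌈ n /2⌉ ≤ q ⊎ (⌈ n /2⌉ ≤ suc p × ⌈ n /2⌉ ≤ suc q)
-- The spare vertex is counted first with `p`, then with `q`; if neither part is large enough alone,
-- each is so with the spare vertex added.
n≤1+p+q⇒⌈n/2⌉≤ n {p} {q} n≤1+p+q with n≤p+q⇒⌈n/2⌉≤ n {suc p} {q} n≤1+p+q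
... | inj₂ ≤q = inj₂ (inj₁ ≤q)
... | inj₁ ≤1+p
  with n≤p+q⇒⌈n/2⌉≤ n {p} {suc q} (≤-trans n≤1+p+q (≤-reflexive (≡.sym (ℕ.+-suc p q))))
...   | inj₁ ≤p   = inj₁ ≤p
...   | inj₂ ≤1+q = inj₂ (inj₂ (≤1+p , ≤1+q))

-- The lower bound

-- The symmetry of the forbidden family that exchanges blue and yellow.
flip : Colour → Colour
flip r = r
flip b = y
flip y = b

≢r∧≢⇒≡flip : ∀ {γ δ} → γ ≢ r → δ ≢ r → δ ≢ γ → δ ≡ flip γ
≢r∧≢⇒≡flip {r}     γ≢r _ _ = contradiction refl γ≢r
≢r∧≢⇒≡flip {b} {r} _ δ≢r _ = contradiction refl δ≢r
≢r∧≢⇒≡flip {b} {b} _ _ δ≢γ = contradiction refl δ≢γ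
≢r∧≢⇒≡flip {b} {y} _ _ _   = refl
≢r∧≢⇒≡flip {y} {r} _ δ≢r _ = contradiction refl δ≢r
≢r∧≢⇒≡flip {y} {b} _ _ _   = refl
≢r∧≢⇒≡flip {y} {y} _ _ δ≢γ = contradiction refl δ≢γ

flip≢ : ∀ {γ} → γ ≢ r → γ ≢ flip γ
flip≢ {r} γ≢r _ = γ≢r refl

module LowerBound (c : EdgeColouring n) (forb : Forb n 𝓗 c) where

  LargeTwoColoured : Set
  LargeTwoColoured = ∃[ S ] ⌈ n /2⌉ ≤ ∣ S ∣ × UsesAtMostTwoColours c S

  private
    symm : ∀ {i j γ} → colour c i j ≡ γ → colour c j i ≡ γ
    symm {i} {j} eq = ≡.trans (EdgeColouring.sym c j i) eq

    -- Supplies the distinctness of vertices that the triangle lemmas require.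
    clash : ∀ {i j k l γ δ} → γ ≢ δ → colour c i j ≡ γ → colour c k l ≡ δ → i ≡ k → j ≢ l
    clash γ≢δ p q refl refl = γ≢δ (≡.trans (≡.sym p) q)

  -- Colours forced by the forbidden triangles, and cliques without red

  noRedTriangle : ∀ {i j k} → i ≢ j → j ≢ k → i ≢ k →
                  colour c i j ≡ r → colour c j k ≡ r → colour c i k ≢ r
  noRedTriangle {i} {j} {k} i≢j j≢k i≢k ij jk ik =
    forb i j k i≢j j≢k i≢k rrr (here refl) rrr-triangle
    where
    rrr-triangle : HasPattern c i j k rrr
    rrr-triangle rewrite ij | jk | ik = refl

  -- A blue third edge would complete `bby`, a yellow one `yyb`.
  blueYellow⇒red : ∀ {v i j} → v ≢ i → v ≢ j →
                   colour c v i ≡ b → colour c v j ≡ y → colour c i j ≡ r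
  blueYellow⇒red {v} {i} {j} v≢i v≢j vi vj with colour c i j in ij
  ... | r = refl
  ... | b = ⊥-elim (forb v i j v≢i (clash (λ ()) vi vj refl) v≢j bby
                     (there (here refl)) bby-triangle)
    where
    bby-triangle : HasPattern c v i j bby
    bby-triangle rewrite vi | ij | vj = refl
  ... | y = ⊥-elim (forb v i j v≢i (clash (λ ()) vi vj refl) v≢j yyb
                     (there (there (here refl))) yyb-triangle)
    where
    yyb-triangle : HasPattern c v i j yyb
    yyb-triangle rewrite vi | ij | vj = trans (swap b y refl) (prep y (swap b y refl))

  mixed⇒red : ∀ γ {v i j} → γ ≢ r → v ≢ i → v ≢ j →
              colour c v i ≡ γ → colour c v j ≡ flip γ → colour c i j ≡ r
  mixed⇒red r γ≢r _ _ _ _ = contradiction refl γ≢r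
  mixed⇒red b _ v≢i v≢j vi vj = blueYellow⇒red v≢i v≢j vi vj
  mixed⇒red y _ v≢i v≢j vi vj = symm (blueYellow⇒red v≢j v≢i vj vi)

  -- A vertex with a blue and a yellow edge inside `Q` would force a red edge in `Q`. So one yellow
  -- edge `i j` makes all edges at `i` yellow, and this spreads to the other vertices.
  monochromatic : ∀ {Q} → Avoids c r Q → Avoids c y Q ⊎ Avoids c b Q
  monochromatic {Q} noRed
    with any? (λ i → any? λ j → (i ∈? Q) ×-dec (j ∈? Q) ×-dec ¬? (i ≟ j) ×-dec (colour c i j ≟ᶜ y))
  ... | no  noYellow = inj₁ λ i∈Q j∈Q i≢j ij → noYellow (_ , _ , i∈Q , j∈Q , i≢j , ij)
  ... | yes (i , j , i∈Q , j∈Q , i≢j , ij) = inj₂ noBlue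
    where
    noBlueAt-i : ∀ {k} → k ∈ Q → i ≢ k → colour c i k ≢ b
    noBlueAt-i k∈Q i≢k ik = noRed k∈Q j∈Q (clash (λ ()) ik ij refl)
      (blueYellow⇒red i≢k i≢j ik ij)

    noBlue : Avoids c b Q
    noBlue {k} {l} k∈Q l∈Q k≢l kl with i ≟ k
    ... | yes refl = noBlueAt-i l∈Q k≢l kl
    -- The edge `k i` is yellow, so a blue edge `k l` would make `l i` red.
    ... | no  i≢k  = noRed l∈Q i∈Q l≢i (blueYellow⇒red k≢l (i≢k ∘ ≡.sym) kl ki)
      where
      ki : colour c k i ≡ y
      ki = symm (≢r∧≢⇒≡flip (λ ()) (noRed i∈Q k∈Q i≢k) (noBlueAt-i k∈Q i≢k))
      l≢i : l ≢ i
      l≢i = clash (λ ()) kl ki refl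

  extend : ∀ {Q} x γ → x ∉ Q → ⌈ n /2⌉ ≤ suc ∣ Q ∣ → Avoids c γ Q →
           (∀ {l} → l ∈ Q → colour c x l ≢ γ) → LargeTwoColoured
  extend {Q} x γ x∉Q ≤1+q noγ noγAt-x =
    Q ∪ ⁅ x ⁆ , ≤-trans ≤1+q (x∉p⇒∣p∣<∣p∪⁅x⁆∣ x∉Q) , avoids⇒twoColours c γ avoids
    where
    avoids : Avoids c γ (Q ∪ ⁅ x ⁆)
    avoids i∈ j∈ i≢j ij with x∈p∪q⁻ Q ⁅ x ⁆ i∈ | x∈p∪q⁻ Q ⁅ x ⁆ j∈
    ... | inj₁ i∈Q | inj₁ j∈Q = noγ i∈Q j∈Q i≢j ij
    ... | inj₁ i∈Q | inj₂ j∈x rewrite x∈⁅y⁆⇒x≡y x j∈x = noγAt-x i∈Q (symm ij)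
    ... | inj₂ i∈x | inj₁ j∈Q rewrite x∈⁅y⁆⇒x≡y x i∈x = noγAt-x j∈Q ij
    ... | inj₂ i∈x | inj₂ j∈x =
      i≢j (≡.trans (x∈⁅y⁆⇒x≡y x i∈x) (≡.sym (x∈⁅y⁆⇒x≡y x j∈x)))

  -- A `flip γ` edge from `x` to `l` in `Q`, next to the `γ` edge from `x` to `z`, would make `z l`
  -- red inside `Q`. Hence adding `x` creates no edge of colour `flip γ`.
  extendAlong : ∀ {Q} γ {x z} → γ ≢ r → x ∉ Q → ⌈ n /2⌉ ≤ suc ∣ Q ∣ →
                Avoids c r Q → Avoids c (flip γ) Q →
                z ∈ Q → colour c x z ≡ γ → LargeTwoColoured
  extendAlong {Q} γ {x} {z} γ≢r x∉Q ≤1+q noRed noFlip z∈Q xz =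
    extend x (flip γ) x∉Q ≤1+q noFlip λ l∈Q xl →
      noRed z∈Q l∈Q (clash (flip≢ γ≢r) xz xl refl)
        (mixed⇒red γ γ≢r (x≢ z∈Q) (x≢ l∈Q) xz xl)
    where
    x≢ : ∀ {l} → l ∈ Q → x ≢ l
    x≢ l∈Q refl = x∉Q l∈Q

  twoCliques : ∀ {v u w P Q} → v ∉ P → v ∉ Q → (∀ {x} → x ∈ P → x ∉ Q) →
               n ≤ suc (∣ P ∣ + ∣ Q ∣) → Avoids c r P → Avoids c r Q →
               u ∈ P → colour c v u ≡ b → w ∈ Q → colour c v w ≡ y → LargeTwoColoured
  twoCliques {v} {P = P} {Q} v∉P v∉Q disjoint n≤ noRedP noRedQ u∈P vu w∈Q vw
    with n≤1+p+q⇒⌈n/2⌉≤ n n≤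
  ... | inj₁ ≤p        = P , ≤p , avoids⇒twoColours c r noRedP
  ... | inj₂ (inj₁ ≤q) = Q , ≤q , avoids⇒twoColours c r noRedQ
  ... | inj₂ (inj₂ (≤1+p , ≤1+q)) with monochromatic noRedP | monochromatic noRedQ
  ...   | inj₁ noYellowP | _ = extendAlong b (λ ()) v∉P ≤1+p noRedP noYellowP u∈P vu
  ...   | inj₂ _ | inj₂ noBlueQ = extendAlong y (λ ()) v∉Q ≤1+q noRedQ noBlueQ w∈Q vw
  ...   | inj₂ noBlueP | inj₁ noYellowQ
    -- Now `P` is all yellow and `Q` all blue. If `v` sends no red edge to one of them, it joins
    -- that one; otherwise red edges `v x` and `v z` keep `x z` from being red.
    with any? (λ x → (x ∈? P) ×-dec (colour c v x ≟ᶜ r))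
       | any? (λ z → (z ∈? Q) ×-dec (colour c v z ≟ᶜ r))
  ...     | no noRed | _ = extend v r v∉P ≤1+p noRedP λ x∈P vx → noRed (_ , x∈P , vx)
  ...     | yes _ | no noRed = extend v r v∉Q ≤1+q noRedQ λ z∈Q vz → noRed (_ , z∈Q , vz)
  ...     | yes (x , x∈P , vx) | yes (z , z∈Q , vz) with colour c x z in xz
  ...       | r = ⊥-elim (noRedTriangle v≢x x≢z v≢z vx xz vz)
    where
    v≢x : v ≢ x
    v≢x refl = v∉P x∈P
    v≢z : v ≢ z
    v≢z refl = v∉Q z∈Q
    x≢z : x ≢ z
    x≢z refl = disjoint x∈P z∈Q
  -- A blue `x z` lets `x` join the blue clique `Q`; a yellow one lets `z` join the yellow clique
  -- `P`.
  ...       | b = extendAlong b (λ ()) (disjoint x∈P) ≤1+q noRedQ noYellowQ z∈Q xz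
  ...       | y = extendAlong y (λ ()) (λ z∈P → disjoint z∈P z∈Q) ≤1+p noRedP noBlueP x∈P (symm xz)

  -- The partition at a vertex meeting both blue and yellow

  BlueNeighbour YellowNeighbour : Fin n → Fin n → Set
  BlueNeighbour   v u = v ≢ u × colour c v u ≡ b
  YellowNeighbour v w = v ≢ w × colour c v w ≡ y

  yellowNeighbour? : ∀ v → Decidable (YellowNeighbour v)
  yellowNeighbour? v w = ¬? (v ≟ w) ×-dec (colour c v w ≟ᶜ y)

  blueNeighbour? : ∀ v → Decidable (BlueNeighbour v)
  blueNeighbour? v u = ¬? (v ≟ u) ×-dec (colour c v u ≟ᶜ b)

  RedToBlueNeighbour : Fin n → Fin n → Set
  RedToBlueNeighbour v x = ∃[ u ] BlueNeighbour v u × x ≢ u × colour c x u ≡ r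

  module BlueYellowVertex {v u₀ w₀} (v-u₀ : BlueNeighbour v u₀) (v-w₀ : YellowNeighbour v w₀) where

    redToBlueNeighbour? : Decidable (RedToBlueNeighbour v)
    redToBlueNeighbour? x =
      any? λ u → blueNeighbour? v u ×-dec ¬? (x ≟ u) ×-dec (colour c x u ≟ᶜ r)

    P Q : Subset n
    Q = comprehension redToBlueNeighbour?
    P = ∁ (Q ∪ ⁅ v ⁆)

    n≤1+∣P∣+∣Q∣ : n ≤ suc (∣ P ∣ + ∣ Q ∣)
    n≤1+∣P∣+∣Q∣ = begin
      n                       ≤⟨ n≤∣p∣+∣∁p∣ (Q ∪ ⁅ v ⁆) ⟩
      ∣ Q ∪ ⁅ v ⁆ ∣ + ∣ P ∣   ≤⟨ ℕ.+-monoˡ-≤ ∣ P ∣ (∣p∪⁅x⁆∣≤1+∣p∣ Q v) ⟩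
      suc (∣ Q ∣ + ∣ P ∣)     ≡⟨ cong suc (ℕ.+-comm ∣ Q ∣ ∣ P ∣) ⟩
      suc (∣ P ∣ + ∣ Q ∣)     ∎
      where open ℕ.≤-Reasoning

    ∈Q⁻ : ∀ {x} → x ∈ Q → RedToBlueNeighbour v x
    ∈Q⁻ = ∈-comprehension⁻ redToBlueNeighbour?

    ∈P⁻ : ∀ {x} → x ∈ P → ¬ RedToBlueNeighbour v x
    ∈P⁻ x∈P red = x∈∁p⇒x∉p x∈P (p⊆p∪q ⁅ v ⁆ (∈-comprehension⁺ redToBlueNeighbour? red))

    v∉P : v ∉ P
    v∉P v∈P = x∈∁p⇒x∉p v∈P (q⊆p∪q Q ⁅ v ⁆ (x∈⁅x⁆ v))

    v∉Q : v ∉ Q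
    v∉Q v∈Q with ∈Q⁻ v∈Q
    ... | u , (_ , vu) , _ , vu′ = clash (λ ()) vu vu′ refl refl

    v≢∈P : ∀ {x} → x ∈ P → v ≢ x
    v≢∈P x∈P refl = v∉P x∈P

    v≢∈Q : ∀ {x} → x ∈ Q → v ≢ x
    v≢∈Q x∈Q refl = v∉Q x∈Q

    blue-yellow≢ : ∀ {u w} → BlueNeighbour v u → YellowNeighbour v w → w ≢ u
    blue-yellow≢ (_ , vu) (_ , vw) = clash (λ ()) vw vu refl

    blue-yellow : ∀ {u w} → BlueNeighbour v u → YellowNeighbour v w → colour c w u ≡ r
    blue-yellow (v≢u , vu) (v≢w , vw) = symm (blueYellow⇒red v≢u v≢w vu vw)

    yellow⇒red : ∀ {x} → YellowNeighbour v x → RedToBlueNeighbour v x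
    yellow⇒red v-x = u₀ , v-u₀ , blue-yellow≢ v-u₀ v-x , blue-yellow v-u₀ v-x

    -- Two blue neighbours of `v` are both joined in red to the yellow neighbour `w₀`, so a red edge
    -- between them would complete a red triangle.
    blue⇒¬red : ∀ {x} → BlueNeighbour v x → ¬ RedToBlueNeighbour v x
    blue⇒¬red v-x (u , v-u , x≢u , xu) =
      noRedTriangle (blue-yellow≢ v-x v-w₀) x≢u (blue-yellow≢ v-u v-w₀)
        (blue-yellow v-x v-w₀) xu (blue-yellow v-u v-w₀)

    noRedP : Avoids c r P
    noRedP {i} {j} i∈P j∈P i≢j ij with colour c v i in vi | colour c v j in vj
    -- Yellow neighbours of `v` lie in `Q`. If one end is a blue neighbour, the red edge `i j` puts
    -- the other end in `Q`. If both ends are joined to `v` in red, `v i j` is a red triangle.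
    ... | y | _ = ∈P⁻ i∈P (yellow⇒red (v≢∈P i∈P , vi))
    ... | _ | y = ∈P⁻ j∈P (yellow⇒red (v≢∈P j∈P , vj))
    ... | b | _ = ∈P⁻ j∈P (i , (v≢∈P i∈P , vi) , i≢j ∘ ≡.sym , symm ij)
    ... | _ | b = ∈P⁻ i∈P (j , (v≢∈P j∈P , vj) , i≢j , ij)
    ... | r | r = noRedTriangle (v≢∈P i∈P) i≢j (v≢∈P j∈P) vi ij vj

    -- The blue neighbour `u` that puts `j` in `Q` is also joined in red to the yellow neighbour
    -- `i`.
    yellow-red : ∀ {i j} → YellowNeighbour v i → j ∈ Q → i ≢ j → colour c i j ≢ r
    yellow-red v-i j∈Q i≢j ij with ∈Q⁻ j∈Q
    ... | u , v-u , j≢u , ju =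
      noRedTriangle i≢j j≢u (blue-yellow≢ v-u v-i) ij ju (blue-yellow v-u v-i)

    noRedQ : Avoids c r Q
    noRedQ {i} {j} i∈Q j∈Q i≢j ij with colour c v i in vi | colour c v j in vj
    ... | b | _ = blue⇒¬red (v≢∈Q i∈Q , vi) (∈Q⁻ i∈Q)
    ... | _ | b = blue⇒¬red (v≢∈Q j∈Q , vj) (∈Q⁻ j∈Q)
    ... | y | _ = yellow-red (v≢∈Q i∈Q , vi) j∈Q i≢j ij
    ... | _ | y = yellow-red (v≢∈Q j∈Q , vj) i∈Q (i≢j ∘ ≡.sym) (symm ij)
    ... | r | r = noRedTriangle (v≢∈Q i∈Q) i≢j (v≢∈Q j∈Q) vi ij vj

    u₀∈P : u₀ ∈ P
    u₀∈P = x∉p⇒x∈∁p λ u₀∈ →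
      [ (λ u₀∈Q → blue⇒¬red v-u₀ (∈Q⁻ u₀∈Q))
      , (λ u₀∈v → proj₁ v-u₀ (≡.sym (x∈⁅y⁆⇒x≡y v u₀∈v))) ]′ (x∈p∪q⁻ Q ⁅ v ⁆ u₀∈)

    largeTwoColoured : LargeTwoColoured
    largeTwoColoured = twoCliques v∉P v∉Q (λ x∈P x∈Q → ∈P⁻ x∈P (∈Q⁻ x∈Q))
      n≤1+∣P∣+∣Q∣ noRedP noRedQ u₀∈P (proj₂ v-u₀)
      (∈-comprehension⁺ redToBlueNeighbour? (yellow⇒red v-w₀)) (proj₂ v-w₀)

  largeTwoColoured : LargeTwoColoured
  largeTwoColoured with any? (λ v → any? (blueNeighbour? v) ×-dec any? (yellowNeighbour? v))
  ... | yes (v , (u , v-u) , (w , v-w)) = BlueYellowVertex.largeTwoColoured v-u v-w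
  ... | no none with n≤p+q⇒⌈n/2⌉≤ n (n≤∣p∣+∣∁p∣ Y)
    where
    Y : Subset n
    Y = comprehension (λ v → any? (yellowNeighbour? v))
  ...   | inj₁ ≤Y = _ , ≤Y , avoids⇒twoColours c b λ i∈Y _ i≢j ij →
    none (_ , (_ , i≢j , ij) , ∈-comprehension⁻ (λ v → any? (yellowNeighbour? v)) i∈Y)
  ...   | inj₂ ≤∁Y = _ , ≤∁Y , avoids⇒twoColours c y λ i∈∁Y _ i≢j ij →
    x∈∁p⇒x∉p i∈∁Y (∈-comprehension⁺ (λ v → any? (yellowNeighbour? v)) (_ , i≢j , ij))

-- The upper bound

-- The forbidden patterns have total weights 0, 6 and 9, whereas the triangles of
-- the extremal colouring (bbb, brr and bry) have total weights 3, 1 and 5.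
weight : Colour → ℕ
weight r = 0
weight b = 1
weight y = 4

-- `side` tells which blue clique contains a vertex, and `half` labels its edge of the yellow
-- matching.
module Extremal (half : Fin n → Fin m) (side : Fin n → Fin 2)
                (jointly-injective : ∀ {i j} → half i ≡ half j → side i ≡ side j → i ≡ j) where

  -- Takes the decisions as arguments, so that a `with` on them evaluates `χ`.
  extremalColour : ∀ {i j} → Dec (side i ≡ side j) → Dec (half i ≡ half j) → Colour
  extremalColour (yes _) _       = b
  extremalColour (no  _) (yes _) = y
  extremalColour (no  _) (no  _) = r

  χ : Fin n → Fin n → Colour
  χ i j = extremalColour {i} {j} (side i ≟ side j) (half i ≟ half j)

  sameSide : ∀ {i j} → side i ≡ side j → χ i j ≡ b
  sameSide {i} {j} s with side i ≟ side j
  ... | yes _ = refl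
  ... | no ¬s = contradiction s ¬s

  matched : ∀ {i j} → side i ≢ side j → half i ≡ half j → χ i j ≡ y
  matched {i} {j} ¬s h with side i ≟ side j | half i ≟ half j
  ... | yes s | _     = contradiction s ¬s
  ... | no _  | yes _ = refl
  ... | no _  | no ¬h = contradiction h ¬h

  unmatched : ∀ {i j} → side i ≢ side j → half i ≢ half j → χ i j ≡ r
  unmatched {i} {j} ¬s ¬h with side i ≟ side j | half i ≟ half j
  ... | yes s | _     = contradiction s ¬s
  ... | no _  | yes h = contradiction h ¬h
  ... | no _  | no _  = refl

  χ-sym : ∀ i j → χ i j ≡ χ j i
  χ-sym i j with side i ≟ side j | half i ≟ half j
  ... | yes s | _     = ≡.sym (sameSide (≡.sym s))
  ... | no ¬s | yes h = ≡.sym (matched (¬s ∘ ≡.sym) (≡.sym h))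
  ... | no ¬s | no ¬h = ≡.sym (unmatched (¬s ∘ ≡.sym) (¬h ∘ ≡.sym))

  extremal : EdgeColouring n
  extremal = record { colour = χ ; sym = χ-sym }

  sidesOpposite : ∀ {s t u : Fin 2} → s ≢ t → s ≢ u → t ≡ u
  sidesOpposite {zero}     {zero}     s≢t _   = contradiction refl s≢t
  sidesOpposite {zero}     {suc zero} {zero}     _ s≢u = contradiction refl s≢u
  sidesOpposite {zero}     {suc zero} {suc zero} _ _   = refl
  sidesOpposite {suc zero} {suc zero} s≢t _   = contradiction refl s≢t
  sidesOpposite {suc zero} {zero} {suc zero} _ s≢u = contradiction refl s≢u
  sidesOpposite {suc zero} {zero} {zero} _ _   = refl

  -- Either all three vertices share a side, or exactly two do. In the latter case the third vertex
  -- is matched to at most one of the two, by joint injectivity.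
  triangleWeight : ∀ {i j k} → i ≢ j → j ≢ k → i ≢ k →
                   let w = sum (map weight (χ i j ∷ χ j k ∷ χ i k ∷ [])) in
                   w ≡ 3 ⊎ w ≡ 1 ⊎ w ≡ 5
  triangleWeight {i} {j} {k} i≢j j≢k i≢k
    with side i ≟ side j | side j ≟ side k | side i ≟ side k
       | half i ≟ half j | half j ≟ half k | half i ≟ half k
  ... | yes _  | yes _  | yes _  | _ | _ | _ = inj₁ refl
  ... | yes ij | yes jk | no ¬ik | _ | _ | _ = contradiction (≡.trans ij jk) ¬ik
  ... | yes ij | no ¬jk | yes ik | _ | _ | _ = contradiction (≡.trans (≡.sym ij) ik) ¬jk
  ... | no ¬ij | yes jk | yes ik | _ | _ | _ = contradiction (≡.trans ik (≡.sym jk)) ¬ij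
  ... | no ¬ij | no ¬jk | no ¬ik | _ | _ | _ = contradiction (sidesOpposite ¬ij ¬ik) ¬jk
  ... | yes ij | no _   | no _   | _ | yes jk | yes ik =
    contradiction (jointly-injective (≡.trans ik (≡.sym jk)) ij) i≢j
  ... | yes _  | no _   | no _   | _ | yes _ | no _  = inj₂ (inj₂ refl)
  ... | yes _  | no _   | no _   | _ | no _  | yes _ = inj₂ (inj₂ refl)
  ... | yes _  | no _   | no _   | _ | no _  | no _  = inj₂ (inj₁ refl)
  ... | no _   | yes jk | no _   | yes ij | _ | yes ik =
    contradiction (jointly-injective (≡.trans (≡.sym ij) ik) jk) j≢k
  ... | no _   | yes _  | no _   | yes _ | _ | no _  = inj₂ (inj₂ refl)
  ... | no _   | yes _  | no _   | no _  | _ | yes _ = inj₂ (inj₂ refl)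
  ... | no _   | yes _  | no _   | no _  | _ | no _  = inj₂ (inj₁ refl)
  ... | no _   | no _   | yes ik | yes ij | yes jk | _ =
    contradiction (jointly-injective (≡.trans ij jk) ik) i≢k
  ... | no _   | no _   | yes _  | yes _ | no _  | _ = inj₂ (inj₂ refl)
  ... | no _   | no _   | yes _  | no _  | yes _ | _ = inj₂ (inj₂ refl)
  ... | no _   | no _   | yes _  | no _  | no _  | _ = inj₂ (inj₁ refl)

  -- Total weight is invariant under permutation, so forbidden patterns are excluded by comparing
  -- numbers.
  patternWeight : ∀ {i j k p} → HasPattern extremal i j k p →
                  sum (map weight (χ i j ∷ χ j k ∷ χ i k ∷ [])) ≡ sum (map weight (toList p))
  patternWeight perm = sum-↭ (map⁺ weight perm)

  forbidden : ∀ {p w} → p ∈ˡ 𝓗 → w ≡ sum (map weight (toList p)) → ¬ (w ≡ 3 ⊎ w ≡ 1 ⊎ w ≡ 5)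
  forbidden (here refl)                 refl (inj₁ ())
  forbidden (here refl)                 refl (inj₂ (inj₁ ()))
  forbidden (here refl)                 refl (inj₂ (inj₂ ()))
  forbidden (there (here refl))         refl (inj₁ ())
  forbidden (there (here refl))         refl (inj₂ (inj₁ ()))
  forbidden (there (here refl))         refl (inj₂ (inj₂ ()))
  forbidden (there (there (here refl))) refl (inj₁ ())
  forbidden (there (there (here refl))) refl (inj₂ (inj₁ ()))
  forbidden (there (there (here refl))) refl (inj₂ (inj₂ ()))

  extremal-forb : Forb n 𝓗 extremal
  extremal-forb i j k i≢j j≢k i≢k p p∈𝓗 perm =
    forbidden p∈𝓗 (patternWeight {p = p} perm) (triangleWeight i≢j j≢k i≢k)

  -- Without yellow, `S` meets each matching edge at most once; without blue, each side at most
  -- once. Without red, `S` again meets each matching edge at most once, or it contains both ends of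
  -- one and nothing else.
  avoids⇒∣S∣≤ : ∀ γ {S} → Avoids extremal γ S → ∣ S ∣ ≤ m ⊎ ∣ S ∣ ≤ 2
  avoids⇒∣S∣≤ y {S} noYellow = inj₁ (injectiveOn⇒∣S∣≤ S half λ {i} {j} i∈S j∈S h →
    decidable-stable (i ≟ j) λ i≢j →
      noYellow i∈S j∈S i≢j (matched (i≢j ∘ jointly-injective h) h))
  avoids⇒∣S∣≤ b {S} noBlue = inj₂ (injectiveOn⇒∣S∣≤ S side λ {i} {j} i∈S j∈S s →
    decidable-stable (i ≟ j) λ i≢j → noBlue i∈S j∈S i≢j (sameSide s))
  avoids⇒∣S∣≤ r {S} noRed
    with any? (λ i → any? λ j → (i ∈? S) ×-dec (j ∈? S) ×-dec ¬? (i ≟ j) ×-dec (half i ≟ half j))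
  ... | no  none = inj₁ (injectiveOn⇒∣S∣≤ S half λ {i} {j} i∈S j∈S h →
    decidable-stable (i ≟ j) λ i≢j → none (i , j , i∈S , j∈S , i≢j , h))
  ... | yes (i , j , i∈S , j∈S , i≢j , h) = inj₂ (injectiveOn⇒∣S∣≤ S side λ k∈S l∈S →
    jointly-injective (≡.trans (half≡ k∈S) (≡.sym (half≡ l∈S))))
    where
    opposite⇒half≡ : ∀ {k l} → k ∈ S → l ∈ S → side k ≢ side l → half k ≡ half l
    opposite⇒half≡ {k} {l} k∈S l∈S ¬s = decidable-stable (half k ≟ half l) λ ¬h →
      noRed k∈S l∈S (¬s ∘ cong side) (unmatched ¬s ¬h)

    half≡ : ∀ {k} → k ∈ S → half k ≡ half i
    half≡ {k} k∈S with side k ≟ side i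
    ... | no ¬s = opposite⇒half≡ k∈S i∈S ¬s
    -- The matched vertices `i` and `j` lie on opposite sides, so `k`, being on the side of `i`, is
    -- opposite `j`.
    ... | yes s = ≡.trans
      (opposite⇒half≡ k∈S j∈S λ s′ → i≢j (jointly-injective h (≡.trans (≡.sym s) s′)))
      (≡.sym h)

-- The extremal colouring for a given number of vertices, and the value

n≤⌈n/2⌉*2 : ∀ n → n ≤ ⌈ n /2⌉ * 2
n≤⌈n/2⌉*2 zero          = z≤n
n≤⌈n/2⌉*2 (suc zero)    = s≤s z≤n
n≤⌈n/2⌉*2 (suc (suc n)) = s≤s (s≤s (n≤⌈n/2⌉*2 n))

-- Quotient and remainder modulo 2 match each even position with its successor; for odd `n` the last
-- vertex stays unmatched.
module Halves (n : ℕ) where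

  position : Fin n → Fin (⌈ n /2⌉ * 2)
  position i = inject≤ i (n≤⌈n/2⌉*2 n)

  half : Fin n → Fin ⌈ n /2⌉
  half = quotient 2 ∘ position

  side : Fin n → Fin 2
  side = remainder {⌈ n /2⌉} 2 ∘ position

  jointly-injective : ∀ {i j} → half i ≡ half j → side i ≡ side j → i ≡ j
  jointly-injective {i} {j} h s = inject≤-injective _ _ i j (begin
    position i                                     ≡⟨ combine-remQuot {⌈ n /2⌉} 2 (position i) ⟨
    combine (half i) (side i)                      ≡⟨ cong₂ combine h s ⟩
    combine (half j) (side j)                      ≡⟨ combine-remQuot {⌈ n /2⌉} 2 (position j) ⟩
    position j                                     ∎)
    where open ≡.≡-Reasoning

  open Extremal half side jointly-injective public

-- Below two vertices `⌈ n /2⌉` equals `n`, and from three on it is at least 2. At `n = 2` it is 1,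
-- while a pair of vertices is two-coloured.
∣S∣≤2⇒∣S∣≤⌈n/2⌉ : ∀ n → n ≢ 2 → (S : Subset n) → ∣ S ∣ ≤ 2 → ∣ S ∣ ≤ ⌈ n /2⌉
∣S∣≤2⇒∣S∣≤⌈n/2⌉ zero                n≢2 S _  = ∣p∣≤n S
∣S∣≤2⇒∣S∣≤⌈n/2⌉ (suc zero)          n≢2 S _  = ∣p∣≤n S
∣S∣≤2⇒∣S∣≤⌈n/2⌉ (suc (suc zero))    n≢2 S _  = contradiction refl n≢2
∣S∣≤2⇒∣S∣≤⌈n/2⌉ (suc (suc (suc n))) n≢2 S ≤2 = ≤-trans ≤2 (s≤s (s≤s z≤n))

-- Applied prefix, as h₂[ n , 𝓗 ]≡_ would also parse as h₂[_]≡_ of a pair.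
lemma3p23 : (n : ℕ) → n ≢ 2 → h₂[_,_]≡_ n 𝓗 ⌈ n /2⌉
lemma3p23 n n≢2 = attained , minimal
  where
  open Halves n

  upper : ∀ {S} → UsesAtMostTwoColours extremal S → ∣ S ∣ ≤ ⌈ n /2⌉
  upper {S} two with twoColours⇒avoids extremal two
  ... | γ , avoids = [ id , ∣S∣≤2⇒∣S∣≤⌈n/2⌉ n n≢2 S ]′ (avoids⇒∣S∣≤ γ avoids)

  attained : ∃ λ c → Forb n 𝓗 c × h₂[ c ]≡ ⌈ n /2⌉
  -- The lower bound, applied to the extremal colouring itself, supplies the two-coloured set that
  -- attains its maximum.
  attained with LowerBound.largeTwoColoured extremal extremal-forb
  ... | S , ≤S , two = extremal , extremal-forb ,
    (S , ≤-antisym (upper two) ≤S , two) , λ { k (S′ , refl , two′) → upper two′ }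

  minimal : ∀ k → (∃ λ c → Forb n 𝓗 c × h₂[ c ]≡ k) → ⌈ n /2⌉ ≤ k
  minimal k (c , forb , _ , k-max) with LowerBound.largeTwoColoured c forb
  ... | S , ≤S , two = ≤-trans ≤S (k-max _ (S , refl , two))
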